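{- For all integers $a,b\geq 1$, the complete bipartite graph $K_{a,b}$ satisfies $\mathrm{dem}(K_{a,b})=\mathrm{vc}(K_{a,b})=\min\{a,b\}$. For every integer $d\geq 1$, the hypercube $H_d$ of dimension $d$ satisfies $\mathrm{dem}(H_d)=\mathrm{vc}(H_d)=2^{d-1}$.
   Context: $K_{a,b}$ is the complete bipartite graph with parts of sizes $a$ and $b$; $H_d$ is the $d$-dimensional hypercube graph. For a finite simple connected graph $G$, $d_G(x,y)$ denotes the distance between vertices $x,y$ in $G$ (equal to $\infty$ if $x$ and $y$ are in different components), and $G-e$ is the graph obtained from $G$ by deleting the edge $e$. An edge $e$ of $G$ is monitored by a vertex $x$ if there is a vertex $y$ of $G$ with $d_G(x,y)\neq d_{G-e}(x,y)$ (equivalently, $e$ belongs to all shortest paths between $x$ and $y$ in $G$). A set $M\subseteq V(G)$ is distance-edge-monitoring if every edge of $G$ is monitored by some vertex of $M$, and $\mathrm{dem}(G)$ is the smallest size of a distance-edge-monitoring set of $G$. $\mathrm{vc}(G)$ is the smallest size of a vertex cover of $G$ (a set of vertices containing at least one endpoint of every edge). -}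

module Defs where

open import Data.Bool using (Bool)
import Data.Bool.Properties as Bool
open import Data.Empty using (⊥)
open import Data.Fin using (Fin; zero)
import Data.Fin.Properties as Fin
open import Data.List using (List; length)
open import Data.List.Membership.Propositional using (_∈_)
open import Data.List.Relation.Unary.Unique.Propositional using (Unique)
open import Data.Nat using (ℕ; zero; suc; _+_; _^_; _≤_)
open import Data.Product using (∃-syntax; _×_; _,_; swap; uncurry)
open import Data.Product.Function.NonDependent.Propositional using (_×-↔_)
open import Data.Sum using (_⊎_; inj₁; inj₂)
import Data.Sum as Sum
open import Data.Unit using (⊤; tt)
open import Data.Vec using (Vec; []; _∷_; lookup)
open import Function using (_∘_; _↔_; mk↔ₛ′)
open import Function.Properties.Inverse using (↔-sym; ↔-trans; ↔⇒↣)
open import Relation.Binary using (Symmetric; Irreflexive; Decidable; DecidableEquality)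
open import Relation.Binary.Construct.Closure.ReflexiveTransitive using (Star; ε; _◅_)
open import Relation.Binary.PropositionalEquality using (_≡_; _≢_; refl; ≢-sym) renaming (sym to ≡-sym)
open import Relation.Nullary using (¬_; yes; no; ¬?; _×-dec_; _⊎-dec_; _→-dec_)
open import Relation.Nullary.Construct.Add.Supremum using (_⁺; [_]) renaming (⊤⁺ to ∞)

record Graph : Set₁ where
  field
    V      : Set
    Adj    : V → V → Set
    sym    : Symmetric Adj
    irrefl : Irreflexive _≡_ Adj
    adj?   : Decidable Adj
    order  : ℕ
    finite : V ↔ Fin order

  _≟_ : DecidableEquality V
  _≟_ = Fin.inj⇒≟ (↔⇒↣ finite)

  -- Either orientation represents the same undirected edge; every notion
  -- below treats the two endpoints symmetrically.
  record Edge : Set where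
    constructor edge
    field
      u v : V
      adj : Adj u v

open Graph using (V; Adj; Edge)

_-_ : (G : Graph) → Edge G → Graph
G - e = record
  { V      = V G
  ; Adj    = λ x y → Adj G x y × ¬ Joins x y
  ; sym    = λ (a , ¬j) → Graph.sym G a , ¬j ∘ Sum.swap ∘ Sum.map swap swap
  ; irrefl = λ x≡y (a , _) → Graph.irrefl G x≡y a
  ; adj?   = λ x y → Graph.adj? G x y ×-dec
               ¬? (((x ≟ u) ×-dec (y ≟ v)) ⊎-dec ((x ≟ v) ×-dec (y ≟ u)))
  ; order  = Graph.order G
  ; finite = Graph.finite G
  }
  where
  open Graph G using (_≟_)
  open Edge e using (u; v)

  Joins : V G → V G → Set
  Joins x y = (x ≡ u × y ≡ v) ⊎ (x ≡ v × y ≡ u)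

Walk : (G : Graph) → V G → V G → Set
Walk G = Star (Adj G)

walkLength : ∀ (G : Graph) {x y : V G} → Walk G x y → ℕ
walkLength G ε       = 0
walkLength G (_ ◅ w) = suc (walkLength G w)

-- IsDistance G x y δ says d_G(x,y) = δ, where δ ranges over ℕ ∪ {∞}.
IsDistance : (G : Graph) → V G → V G → ℕ ⁺ → Set
IsDistance G x y [ n ] =
  (∃[ w ] walkLength G {x} {y} w ≡ n) × (∀ (w : Walk G x y) → n ≤ walkLength G w)
IsDistance G x y ∞     = ¬ Walk G x y

Monitors : (G : Graph) → V G → Edge G → Set
Monitors G x e =
  ∃[ y ] ∃[ δ ] ∃[ δ′ ] IsDistance G x y δ × IsDistance (G - e) x y δ′ × δ ≢ δ′

IsDistanceEdgeMonitoring : (G : Graph) → List (V G) → Set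
IsDistanceEdgeMonitoring G M = ∀ (e : Edge G) → ∃[ x ] x ∈ M × Monitors G x e

IsVertexCover : (G : Graph) → List (V G) → Set
IsVertexCover G C = ∀ (e : Edge G) → Edge.u e ∈ C ⊎ Edge.v e ∈ C

-- Vertex sets are duplicate-free lists, so that length is cardinality.
record IsSmallestSize (G : Graph) (P : List (V G) → Set) (k : ℕ) : Set where
  field
    attained : ∃[ M ] Unique M × P M × length M ≡ k
    minimal  : ∀ M → Unique M → P M → k ≤ length M

-- IsDem G k says dem(G) = k, and IsVc G k says vc(G) = k.
IsDem : Graph → ℕ → Set
IsDem G = IsSmallestSize G (IsDistanceEdgeMonitoring G)

IsVc : Graph → ℕ → Set
IsVc G = IsSmallestSize G (IsVertexCover G)

K : ℕ → ℕ → Graph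
K a b = record
  { V      = Fin a ⊎ Fin b
  ; Adj    = _~_
  ; sym    = λ {x} {y} → ~-sym x y
  ; irrefl = λ {x} → ~-irrefl x
  ; adj?   = _~?_
  ; order  = a + b
  ; finite = ↔-sym Fin.+↔⊎
  }
  where
  _~_ : Fin a ⊎ Fin b → Fin a ⊎ Fin b → Set
  inj₁ _ ~ inj₁ _ = ⊥
  inj₁ _ ~ inj₂ _ = ⊤
  inj₂ _ ~ inj₁ _ = ⊤
  inj₂ _ ~ inj₂ _ = ⊥

  ~-sym : ∀ x y → x ~ y → y ~ x
  ~-sym (inj₁ _) (inj₂ _) _ = tt
  ~-sym (inj₂ _) (inj₁ _) _ = tt

  ~-irrefl : ∀ x {y} → x ≡ y → ¬ (x ~ y)
  ~-irrefl (inj₁ _) refl ()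
  ~-irrefl (inj₂ _) refl ()

  _~?_ : Decidable _~_
  inj₁ _ ~? inj₁ _ = no λ ()
  inj₁ _ ~? inj₂ _ = yes tt
  inj₂ _ ~? inj₁ _ = yes tt
  inj₂ _ ~? inj₂ _ = no λ ()

Vec-Bool↔Fin : ∀ d → Vec Bool d ↔ Fin (2 ^ d)
Vec-Bool↔Fin zero    =
  mk↔ₛ′ (λ _ → zero) (λ _ → []) (λ { zero → refl }) (λ { [] → refl })
Vec-Bool↔Fin (suc d) = ↔-trans uncons↔ (↔-trans (↔-sym Fin.2↔Bool ×-↔ Vec-Bool↔Fin d) (↔-sym Fin.*↔×))
  where
  uncons↔ : Vec Bool (suc d) ↔ (Bool × Vec Bool d)
  uncons↔ = mk↔ₛ′ (λ { (b ∷ bs) → b , bs }) (uncurry _∷_) (λ _ → refl) (λ { (_ ∷ _) → refl })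

H : ℕ → Graph
H d = record
  { V      = Vec Bool d
  ; Adj    = λ x y → ∃[ i ] DifferExactlyAt i x y
  ; sym    = λ (i , x≢y , x≡y) → i , ≢-sym x≢y , λ j j≢i → ≡-sym (x≡y j j≢i)
  ; irrefl = λ { refl (_ , x≢x , _) → x≢x refl }
  ; adj?   = λ x y → Fin.any? λ i →
               ¬? (lookup x i Bool.≟ lookup y i) ×-dec
               Fin.all? λ j → ¬? (j Fin.≟ i) →-dec (lookup x j Bool.≟ lookup y j)
  ; order  = 2 ^ d
  ; finite = Vec-Bool↔Fin d
  }
  where
  DifferExactlyAt : Fin d → Vec Bool d → Vec Bool d → Set
  DifferExactlyAt i x y = lookup x i ≢ lookup y i × (∀ j → j ≢ i → lookup x j ≡ lookup y j)

{-# OPTIONS --safe #-}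
-- The endpoints of an edge always monitor it, so every vertex cover is
-- distance-edge-monitoring. The converse holds as soon as every path w - u - v
-- with w ≠ v has a second middle vertex u′: a walk starting off the edge e can
-- then replace each passage through e by one through such a u′, without getting
-- longer, so only the endpoints of e monitor e. Both K_{a,b} with a, b ≥ 2 and
-- all hypercubes have this property. Vertex covers are bounded below by perfect
-- (in K_{a,b}: maximum) matchings.
module Submission where

open import Defs
open import Data.Nat using (ℕ; _≤_; _⊓_; _∸_; _^_)
open import Data.Product using (_×_)

open import Data.Bool using (Bool; true; false; _xor_)
import Data.Bool.Properties as Bool
open import Data.Fin using (Fin; zero; suc; toℕ; inject≤)
import Data.Fin.Properties as Fin
open import Data.List using (List; []; _∷_; length; map; tabulate)
open import Data.List.Membership.Propositional using (_∈_; lose)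
open import Data.List.Membership.Propositional.Properties
  using (∈-tabulate⁺; ∈-map⁺; ∈-length)
open import Data.List.Membership.Setoid.Properties using (index-injective)
open import Data.List.Properties using (length-map; length-tabulate)
open import Data.List.Relation.Unary.Any as Any using (here; there)
open import Data.List.Relation.Unary.Unique.Propositional using (Unique)
import Data.List.Relation.Unary.Unique.Propositional.Properties as Unique
open import Data.Nat using (zero; suc; _<_; z≤n; s≤s; _≤?_)
open import Data.Nat.Induction using (<-rec)
open import Data.Nat.Properties as ℕ using (≤-refl; ≤-trans)
open import Data.Product using (∃-syntax; _,_; proj₁; proj₂; map₁; map₂)
open import Data.Sum using (_⊎_; inj₁; inj₂; [_,_]′)
open import Data.Sum.Properties using (inj₁-injective; inj₂-injective)
open import Data.Unit using (tt)
open import Data.Vec using (Vec; []; _∷_; lookup; tail; _[_]≔_)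
open import Data.Vec.Properties
  using (∷-injectiveʳ; lookup∘update; lookup∘update′; tabulate∘lookup; tabulate-cong)
open import Function using (_∘_; id; Inverse)
open import Function.Definitions using (Injective)
open import Function.Properties.Inverse using (↔-sym; ↔⇒↣)
open import Function.Bundles using (Injection)
open import Relation.Binary using (Decidable; DecidableEquality)
open import Relation.Binary.Construct.Closure.ReflexiveTransitive using (Star; ε; _◅_; _◅◅_)
open import Relation.Binary.PropositionalEquality
  using (_≡_; _≢_; refl; sym; trans; cong; subst; setoid; ≢-sym)
open import Relation.Nullary using (¬_; Dec; yes; no; contradiction)
open import Relation.Nullary.Decidable using (map′; _×-dec_; _⊎-dec_)
open import Relation.Nullary.Construct.Add.Supremum using ([_]) renaming (⊤⁺ to ∞)

open Graph using (V; Adj; Edge; edge)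

-- Reachability and distances are computable in finite graphs.

module _ {A : Set} (_≟_ : DecidableEquality A) {R : A → A → Set} (R? : Decidable R) where

  private
    -- As in Warshall's algorithm: all intermediate vertices lie in the list.
    Via : List A → A → A → Set
    Via []       x y = x ≡ y ⊎ R x y
    Via (z ∷ zs) x y = Via zs x y ⊎ (Via zs x z × Via zs z y)

    via? : ∀ zs → Decidable (Via zs)
    via? []       x y = (x ≟ y) ⊎-dec R? x y
    via? (z ∷ zs) x y = via? zs x y ⊎-dec (via? zs x z ×-dec via? zs z y)

    via⇒star : ∀ zs {x y} → Via zs x y → Star R x y
    via⇒star []       (inj₁ refl)    = ε
    via⇒star []       (inj₂ r)       = r ◅ ε
    via⇒star (z ∷ zs) (inj₁ p)       = via⇒star zs p
    via⇒star (z ∷ zs) (inj₂ (p , q)) = via⇒star zs p ◅◅ via⇒star zs q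

    via-base : ∀ zs {x y} → Via [] x y → Via zs x y
    via-base []       p = p
    via-base (_ ∷ zs) p = inj₁ (via-base zs p)

    via-trans : ∀ zs {x y z} → z ∈ zs → Via zs x z → Via zs z y → Via zs x y
    via-trans (_ ∷ zs) (here refl) p q = inj₂ ([ id , proj₁ ]′ p , [ id , proj₂ ]′ q)
    via-trans (_ ∷ zs) (there z∈) (inj₁ p)       (inj₁ q)       = inj₁ (via-trans zs z∈ p q)
    via-trans (_ ∷ zs) (there z∈) (inj₁ p)       (inj₂ (q , r)) = inj₂ (via-trans zs z∈ p q , r)
    via-trans (_ ∷ zs) (there z∈) (inj₂ (p , q)) (inj₁ r)       = inj₂ (p , via-trans zs z∈ q r)
    -- Both pieces visit the head of the list, so everything between the two visits is cut out.
    via-trans (_ ∷ zs) (there z∈) (inj₂ (p , _)) (inj₂ (_ , q)) = inj₂ (p , q)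

  star? : ∀ zs → (∀ z → z ∈ zs) → Decidable (Star R)
  star? zs complete x y = map′ (via⇒star zs) star⇒via (via? zs x y)
    where
    star⇒via : ∀ {x y} → Star R x y → Via zs x y
    star⇒via ε       = via-base zs (inj₁ refl)
    star⇒via (r ◅ w) = via-trans zs (complete _) (via-base zs (inj₂ r)) (star⇒via w)

least : ∀ {P : ℕ → Set} → (∀ n → Dec (P n)) → ∀ n → P n → ∃[ m ] P m × (∀ k → P k → m ≤ k)
least {P} P? = <-rec _ step
  where
  step : ∀ n → (∀ {m} → m < n → P m → ∃[ l ] P l × (∀ k → P k → l ≤ k)) →
         P n → ∃[ l ] P l × (∀ k → P k → l ≤ k)
  step n rec Pn with ℕ.anyUpTo? P? n
  ... | yes (m , m<n , Pm) = rec m<n Pm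
  ... | no  none           = n , Pn , λ k Pk → ℕ.≮⇒≥ (λ k<n → none (k , k<n , Pk))

module _ (G : Graph) where

  open Graph G using (_≟_; adj?; order; finite)

  vertices : List (V G)
  vertices = tabulate (Inverse.from finite)

  ∈-vertices : ∀ x → x ∈ vertices
  ∈-vertices x =
    subst (_∈ vertices) (Inverse.strictlyInverseʳ finite x) (∈-tabulate⁺ (Inverse.to finite x))

  vertices-unique : Unique vertices
  vertices-unique = Unique.tabulate⁺ (Injection.injective (↔⇒↣ (↔-sym finite)))

  length-vertices : length vertices ≡ order
  length-vertices = length-tabulate _

  walkOfLength? : ∀ n x y → Dec (∃[ w ] walkLength G {x} {y} w ≡ n)
  walkOfLength? zero    x y = map′ (λ { refl → ε , refl }) (λ { (ε , _) → refl }) (x ≟ y)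
  walkOfLength? (suc n) x y = map′
    ((λ { (_ , a , w , eq) → a ◅ w , cong suc eq }) ∘ Any.satisfied)
    (λ { (_◅_ {j = z} a w , eq) → lose (∈-vertices z) (a , w , ℕ.suc-injective eq) })
    (Any.any? (λ z → adj? x z ×-dec walkOfLength? n z y) vertices)

  -- `Monitors` asks for explicit values of both distances. Deciding reachability first tells `∞`
  -- apart and otherwise supplies a length from which to search for the least one.
  distance : ∀ x y → ∃[ δ ] IsDistance G x y δ
  distance x y with star? _≟_ adj? vertices ∈-vertices x y
  ... | no unreachable = ∞ , unreachable
  ... | yes w with least (λ n → walkOfLength? n x y) (walkLength G w) (w , refl)
  ...   | n , shortest , minimal = [ n ] , shortest , λ w → minimal _ (w , refl)

-- Endpoints monitor their edge.

module _ (G : Graph) where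

  open Graph G using (_≟_; irrefl)

  -- Unfolds to the condition that `G - e` excludes, so a proof of it directly refutes an adjacency
  -- in `G - e`.
  Joins : Edge G → V G → V G → Set
  Joins (edge u v _) x y = (x ≡ u × y ≡ v) ⊎ (x ≡ v × y ≡ u)

  joins-swap : ∀ e {x y} → Joins e x y → Joins e y x
  joins-swap _ (inj₁ (p , q)) = inj₂ (q , p)
  joins-swap _ (inj₂ (p , q)) = inj₁ (q , p)

  joins-endpoint : ∀ e {p q x y} → Joins e p q → Joins e x y → x ≡ p ⊎ x ≡ q
  joins-endpoint _ (inj₁ (refl , refl)) (inj₁ (refl , _)) = inj₁ refl
  joins-endpoint _ (inj₁ (refl , refl)) (inj₂ (refl , _)) = inj₂ refl
  joins-endpoint _ (inj₂ (refl , refl)) (inj₁ (refl , _)) = inj₂ refl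
  joins-endpoint _ (inj₂ (refl , refl)) (inj₂ (refl , _)) = inj₁ refl

  joins? : ∀ e x → Dec (∃[ y ] Joins e x y)
  joins? (edge u v _) x = map′
    [ (λ p → v , inj₁ (p , refl)) , (λ p → u , inj₂ (p , refl)) ]′
    (λ { (_ , inj₁ (p , _)) → inj₁ p ; (_ , inj₂ (p , _)) → inj₂ p })
    ((x ≟ u) ⊎-dec (x ≟ v))

  -- An endpoint is tested against the other endpoint: their distance in `G` is 1, whereas a walk of
  -- length 1 in `G - e` would have to be `e` itself.
  vertexCover⇒monitoring : ∀ {C} → IsVertexCover G C → IsDistanceEdgeMonitoring G C
  vertexCover⇒monitoring cover e@(edge u v a) =
    [ (λ u∈C → u , u∈C , endpoint-monitors a (inj₁ (refl , refl)))
    , (λ v∈C → v , v∈C , endpoint-monitors (Graph.sym G a) (inj₂ (refl , refl)))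
    ]′ (cover e)
    where
    endpoint-monitors : ∀ {x y} → Adj G x y → Joins e x y → Monitors G x e
    endpoint-monitors {x} {y} a j = y , [ 1 ] , δ , ((a ◅ ε , refl) , minimal) , dist , differ dist
      where
      minimal : ∀ w → 1 ≤ walkLength G w
      minimal ε       = contradiction a (irrefl refl)
      minimal (_ ◅ _) = s≤s z≤n

      δ    = proj₁ (distance (G - e) x y)
      dist = proj₂ (distance (G - e) x y)

      differ : ∀ {δ} → IsDistance (G - e) x y δ → [ 1 ] ≢ δ
      differ (((_ , ¬j) ◅ ε , _) , _) refl = ¬j j

-- Only endpoints monitor an edge when cherries lie in squares.

NoLonger : (G G′ : Graph) → V G → V G → V G′ → V G′ → Set
NoLonger G G′ x y x′ y′ =
  ∀ (w : Walk G x y) → ∃[ w′ ] walkLength G′ {x′} {y′} w′ ≤ walkLength G w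

-- A shortest walk on either side yields a walk on the other side that is no longer, so each minimum
-- bounds the other and unreachability transfers both ways.
distance-unique : ∀ G G′ {x y x′ y′ δ δ′} →
  NoLonger G G′ x y x′ y′ → NoLonger G′ G x′ y′ x y →
  IsDistance G x y δ → IsDistance G′ x′ y′ δ′ → δ ≡ δ′
distance-unique _ _ {δ = [ _ ]} {[ _ ]} f g ((w , refl) , m≤) ((w′ , refl) , n≤) =
  cong [_] (ℕ.≤-antisym (≤-trans (m≤ _) (proj₂ (g w′))) (≤-trans (n≤ _) (proj₂ (f w))))
distance-unique _ _ {δ = [ _ ]} {∞} f g ((w , _) , _) none  = contradiction (proj₁ (f w)) none
distance-unique _ _ {δ = ∞} {[ _ ]} f g none ((w′ , _) , _) = contradiction (proj₁ (g w′)) none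
distance-unique _ _ {δ = ∞} {∞} f g _ _ = refl

-- A cherry is a path with two edges; `u′` closes it to the 4-cycle w - u - v - u′.
CherriesInSquares : Graph → Set
CherriesInSquares G = ∀ {w u v} → Adj G w u → Adj G u v → w ≢ v →
  ∃[ u′ ] u′ ≢ u × Adj G w u′ × Adj G u′ v

module _ (G : Graph) (square : CherriesInSquares G) where

  open Graph G using (_≟_; irrefl)

  module _ (e : Edge G) where

    private
      OffEdge : V G → Set
      OffEdge x = ¬ (∃[ y ] Joins G e x y)

      leave : ∀ {x y} → OffEdge x → Adj G x y → Adj (G - e) x y
      leave off a = a , λ j → off (_ , j)

      enter : ∀ {x y} → OffEdge y → Adj G x y → Adj (G - e) x y
      enter off a = a , λ j → off (_ , joins-swap G e j)

      off-edge : ∀ {p q x} → Joins G e p q → x ≢ p → x ≢ q → OffEdge x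
      off-edge j x≢p x≢q (_ , j′) = [ x≢p , x≢q ]′ (joins-endpoint G e j j′)

      -- Every recursive call starts off `e` again. The recursion is on the length bound `n`,
      -- because a replaced middle vertex gives a walk that is not a subterm of the original.
      reroute : ∀ n {x y} → OffEdge x → (w : Walk G x y) → walkLength G w ≤ n →
                ∃[ w′ ] walkLength (G - e) {x} {y} w′ ≤ walkLength G w
      reroute n off ε _ = ε , z≤n
      reroute (suc n) off (_◅_ {j = p} a w) (s≤s w≤n) with joins? G e p
      ... | no off-p = let w′ , le = reroute n off-p w w≤n in leave off a ◅ w′ , s≤s le
      ... | yes (q , j) with w
      -- The walk stops at the endpoint `p`; the step into it comes from a vertex off `e`, hence is
      -- not `e`.
      ...   | ε = leave off a ◅ ε , ≤-refl
      ...   | _◅_ {j = r} b w₂ with r ≟ q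
      -- The walk touches `p` without crossing to `q`, so `r` is off `e` and both steps survive.
      ...     | no r≢q =
        let off-r   = off-edge j (λ r≡p → irrefl (sym r≡p) b) r≢q
            w′ , le = reroute n off-r w₂ (ℕ.<⇒≤ w≤n)
        in leave off a ◅ enter off-r b ◅ w′ , s≤s (s≤s le)
      -- The walk crosses `e` from `p` to `q`. The second middle vertex `p′` between the start and
      -- `q` differs from `p`, and from `q` as its neighbour, so it is off `e` and the remaining
      -- walk through `p′` has the same length.
      ...     | yes refl =
        let p′ , p′≢p , a₁ , b₁ = square a b λ { refl → off (p , joins-swap G e j) }
            off-p′  = off-edge j p′≢p λ p′≡q → irrefl p′≡q b₁
            w′ , le = reroute n off-p′ (b₁ ◅ w₂) w≤n
        in leave off a₁ ◅ w′ , s≤s le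

      forget : ∀ {x y} → NoLonger (G - e) G x y x y
      forget ε             = ε , z≤n
      forget ((a , _) ◅ w) = let w′ , le = forget w in a ◅ w′ , s≤s le

    monitors⇒joins : ∀ {x} → Monitors G x e → ∃[ y ] Joins G e x y
    monitors⇒joins {x} (_ , _ , _ , dist , dist′ , δ≢δ′) with joins? G e x
    ... | yes j  = j
    ... | no off =
      contradiction (distance-unique G (G - e) (λ w → reroute _ off w ≤-refl) forget dist dist′) δ≢δ′

  monitoring⇒vertexCover : ∀ {M} → IsDistanceEdgeMonitoring G M → IsVertexCover G M
  monitoring⇒vertexCover monitoring e with monitoring e
  ... | x , x∈M , m with monitors⇒joins e m
  ...   | _ , inj₁ (refl , _) = inj₁ x∈M
  ...   | _ , inj₂ (refl , _) = inj₂ x∈M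

-- From vertex covers to monitoring sets, and matchings as lower bounds.

monitoring-nonempty : ∀ G {M} → Edge G → IsDistanceEdgeMonitoring G M → 1 ≤ length M
monitoring-nonempty G e monitoring = ∈-length (proj₁ (proj₂ (monitoring e)))

-- The lower bound is a parameter because stars with at least two leaves lack the square property
-- and need another argument.
vc⇒dem : ∀ G {k} → IsVc G k →
  (∀ M → Unique M → IsDistanceEdgeMonitoring G M → k ≤ length M) → IsDem G k
vc⇒dem G vc bound = record
  { attained = map₂ (map₂ (map₁ (vertexCover⇒monitoring G))) (IsSmallestSize.attained vc)
  ; minimal  = bound
  }

square-vc⇒dem : ∀ G {k} → CherriesInSquares G → IsVc G k → IsDem G k
square-vc⇒dem G square vc = vc⇒dem G vc λ M unique →
  IsSmallestSize.minimal vc M unique ∘ monitoring⇒vertexCover G square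

-- A matching is given by its edges m together with a labelling of the vertices
-- that is constant on each edge and distinguishes different edges.
matching≤vertexCover : ∀ G {I : Set} {n C} (m : Fin n → Edge G) (label : V G → I) →
  Injective _≡_ _≡_ (label ∘ Edge.u ∘ m) → (∀ i → label (Edge.v (m i)) ≡ label (Edge.u (m i))) →
  IsVertexCover G C → n ≤ length C
matching≤vertexCover G {C = C} m label injective constant cover =
  -- Pigeonhole on positions in `C`: equal positions hold equal vertices, whose labels identify the
  -- matching edges.
  Fin.injective⇒≤ {f = λ i → Any.index (proj₁ (proj₂ (hit i)))} λ {i} {j} eq →
    let _ , x∈C , label-x = hit i
        _ , y∈C , label-y = hit j
    in injective (trans (sym label-x)
         (trans (cong label (index-injective (setoid _) x∈C y∈C eq)) label-y))
  where
  hit : ∀ i → ∃[ x ] x ∈ C × label x ≡ label (Edge.u (m i))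
  hit i = [ (λ u∈C → _ , u∈C , refl) , (λ v∈C → _ , v∈C , constant i) ]′ (cover (m i))

-- Complete bipartite graphs.

-- The smaller part is a cover. Joining equally numbered vertices gives a matching of the same size,
-- labelled by that number.
K-vc : ∀ a b → IsVc (K a b) (a ⊓ b)
K-vc a b = record
  { attained = attained (ℕ.≤-total a b)
  ; minimal  = λ _ _ → matching≤vertexCover (K a b) matching
                 [ toℕ , toℕ ]′
                 (λ {i} {j} eq → Fin.inject≤-injective ≤a ≤a i j (Fin.toℕ-injective eq))
                 (λ i → trans (Fin.toℕ-inject≤ i ≤b) (sym (Fin.toℕ-inject≤ i ≤a)))
  }
  where
  ≤a = ℕ.m⊓n≤m a b
  ≤b = ℕ.m⊓n≤n a b

  matching : Fin (a ⊓ b) → Edge (K a b)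
  matching i = edge (inj₁ (inject≤ i ≤a)) (inj₂ (inject≤ i ≤b)) tt

  attained : a ≤ b ⊎ b ≤ a → ∃[ C ] Unique C × IsVertexCover (K a b) C × length C ≡ a ⊓ b
  attained (inj₁ a≤b) =
    tabulate inj₁ , Unique.tabulate⁺ inj₁-injective , cover ,
    trans (length-tabulate _) (sym (ℕ.m≤n⇒m⊓n≡m a≤b))
    where
    cover : IsVertexCover (K a b) (tabulate inj₁)
    cover (edge (inj₁ i) (inj₂ _) _) = inj₁ (∈-tabulate⁺ i)
    cover (edge (inj₂ _) (inj₁ i) _) = inj₂ (∈-tabulate⁺ i)
  attained (inj₂ b≤a) =
    tabulate inj₂ , Unique.tabulate⁺ inj₂-injective , cover ,
    trans (length-tabulate _) (sym (ℕ.m≥n⇒m⊓n≡n b≤a))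
    where
    cover : IsVertexCover (K a b) (tabulate inj₂)
    cover (edge (inj₁ _) (inj₂ j) _) = inj₂ (∈-tabulate⁺ j)
    cover (edge (inj₂ j) (inj₁ _) _) = inj₁ (∈-tabulate⁺ j)

another : ∀ {n} → 2 ≤ n → (i : Fin n) → ∃[ j ] j ≢ i
another (s≤s (s≤s _)) zero    = suc zero , λ ()
another (s≤s (s≤s _)) (suc _) = zero , λ ()

-- The ends of a cherry lie in one part, so any other vertex of the opposite part also joins them.
K-square : ∀ {a b} → 2 ≤ a → 2 ≤ b → CherriesInSquares (K a b)
K-square _ 2≤b {inj₁ _} {inj₂ j} {inj₁ _} _ _ _ =
  let k , k≢j = another 2≤b j in inj₂ k , k≢j ∘ inj₂-injective , tt , tt
K-square 2≤a _ {inj₂ _} {inj₁ i} {inj₂ _} _ _ _ =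
  let k , k≢i = another 2≤a i in inj₁ k , k≢i ∘ inj₁-injective , tt , tt

-- A leaf of a star monitors all edges, so in K_{1,b} only the non-emptiness of
-- a monitoring set can be used.
K-dem : ∀ a b → 1 ≤ a → 1 ≤ b → IsDem (K a b) (a ⊓ b)
K-dem a b (s≤s _) (s≤s _) with 2 ≤? a | 2 ≤? b
... | yes 2≤a | yes 2≤b = square-vc⇒dem (K a b) (K-square 2≤a 2≤b) (K-vc a b)
... | no 2≰a  | _       = vc⇒dem (K a b) (K-vc a b) λ _ _ monitoring →
  ≤-trans (≤-trans (ℕ.m⊓n≤m a b) (ℕ.≤-pred (ℕ.≰⇒> 2≰a)))
          (monitoring-nonempty (K a b) (edge (inj₁ zero) (inj₂ zero) tt) monitoring)
... | yes _   | no 2≰b  = vc⇒dem (K a b) (K-vc a b) λ _ _ monitoring →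
  ≤-trans (≤-trans (ℕ.m⊓n≤n a b) (ℕ.≤-pred (ℕ.≰⇒> 2≰b)))
          (monitoring-nonempty (K a b) (edge (inj₁ zero) (inj₂ zero) tt) monitoring)

-- Hypercubes.

lookup-extensional : ∀ {A : Set} {n} (xs ys : Vec A n) →
  (∀ i → lookup xs i ≡ lookup ys i) → xs ≡ ys
lookup-extensional xs ys eq =
  trans (sym (tabulate∘lookup xs)) (trans (tabulate-cong eq) (tabulate∘lookup ys))

≢-≢⇒≡ : ∀ {x y z : Bool} → x ≢ y → y ≢ z → x ≡ z
≢-≢⇒≡ x≢y y≢z = trans (Bool.¬-not x≢y) (sym (Bool.¬-not (≢-sym y≢z)))

-- A cherry flips coordinate `i`, then `j`. If these agree, the path returns to its start; otherwise
-- flipping `j` first gives the other middle vertex.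
H-square : ∀ {d} → CherriesInSquares (H d)
H-square {_} {w} {u} {v} (i , wᵢ≢uᵢ , w≡u) (j , uⱼ≢vⱼ , u≡v) w≢v with i Fin.≟ j
... | yes refl = contradiction (lookup-extensional w v w≡v) w≢v
  where
  w≡v : ∀ k → lookup w k ≡ lookup v k
  w≡v k with k Fin.≟ i
  ... | yes refl = ≢-≢⇒≡ wᵢ≢uᵢ uⱼ≢vⱼ
  ... | no  k≢i  = trans (w≡u k k≢i) (u≡v k k≢i)
... | no i≢j =
  u′ ,
  (λ u′≡u → wᵢ≢uᵢ (trans (sym (u′≡w i i≢j)) (cong (λ x → lookup x i) u′≡u))) ,
  (j , (λ wⱼ≡u′ⱼ → uⱼ≢vⱼ (trans (sym (w≡u j (≢-sym i≢j))) (trans wⱼ≡u′ⱼ u′ⱼ≡vⱼ))) ,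
       λ k k≢j → sym (u′≡w k k≢j)) ,
  (i , (λ u′ᵢ≡vᵢ → wᵢ≢uᵢ (trans (sym (u′≡w i i≢j)) (trans u′ᵢ≡vᵢ (sym (u≡v i i≢j))))) , u′≡v)
  where
  u′ = w [ j ]≔ lookup v j

  u′ⱼ≡vⱼ : lookup u′ j ≡ lookup v j
  u′ⱼ≡vⱼ = lookup∘update j w (lookup v j)

  u′≡w : ∀ k → k ≢ j → lookup u′ k ≡ lookup w k
  u′≡w k k≢j = lookup∘update′ k≢j w (lookup v j)

  u′≡v : ∀ k → k ≢ i → lookup u′ k ≡ lookup v k
  u′≡v k k≢i with k Fin.≟ j
  ... | yes refl = u′ⱼ≡vⱼ
  ... | no  k≢j  = trans (u′≡w k k≢j) (trans (w≡u k k≢i) (u≡v k k≢j))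

xor-cancelˡ : ∀ x {y z} → x xor y ≡ x xor z → y ≡ z
xor-cancelˡ false eq = eq
xor-cancelˡ true  eq = Bool.not-injective eq

xor-cancelʳ : ∀ x y z → x xor z ≡ y xor z → x ≡ y
xor-cancelʳ x y z eq = xor-cancelˡ z (trans (Bool.xor-comm z x) (trans eq (Bool.xor-comm y z)))

parity : ∀ {d} → Vec Bool d → Bool
parity []       = false
parity (x ∷ xs) = x xor parity xs

adjacent-tails : ∀ {d x y} {xs ys : Vec Bool d} → Adj (H (suc d)) (x ∷ xs) (y ∷ ys) →
  (x ≢ y × xs ≡ ys) ⊎ (x ≡ y × Adj (H d) xs ys)
adjacent-tails {xs = xs} {ys} (zero  , x≢y , eq) =
  inj₁ (x≢y , lookup-extensional xs ys λ k → eq (suc k) λ ())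
adjacent-tails (suc i , xs≢ys , eq) =
  inj₂ (eq zero (λ ()) , i , xs≢ys , λ k k≢i → eq (suc k) (k≢i ∘ Fin.suc-injective))

-- This is the bipartition of the hypercube: by induction, either only the head changes or an equal
-- head cancels from both parities.
adjacent-parity : ∀ {d} (x y : Vec Bool d) → Adj (H d) x y → parity x ≢ parity y
adjacent-parity (x ∷ xs) (y ∷ ys) a with adjacent-tails a
... | inj₁ (x≢y , refl)  = x≢y ∘ xor-cancelʳ x y (parity xs)
... | inj₂ (refl , a′) = adjacent-parity xs ys a′ ∘ xor-cancelˡ x

H-vc : ∀ d → IsVc (H (suc d)) (2 ^ d)
H-vc d = record
  -- Each tail has exactly one head making the total parity even, whence the size `2 ^ d`.
  { attained = map complete (vertices (H d)) ,
               Unique.map⁺ ∷-injectiveʳ (vertices-unique (H d)) ,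
               cover ,
               trans (length-map complete (vertices (H d))) (length-vertices (H d))
  -- The edges in the direction of the first coordinate form a perfect matching, and `tail` is a
  -- label for it.
  ; minimal  = λ _ _ → matching≤vertexCover (H (suc d)) matching tail
                 (Injection.injective (↔⇒↣ (↔-sym (Vec-Bool↔Fin d)))) (λ _ → refl)
  }
  where
  -- The vertices of even parity form the cover.
  complete : Vec Bool d → Vec Bool (suc d)
  complete xs = parity xs ∷ xs

  covers : ∀ {x} xs → x ≡ parity xs → (x ∷ xs) ∈ map complete (vertices (H d))
  covers xs refl = ∈-map⁺ complete (∈-vertices (H d) xs)

  cover : IsVertexCover (H (suc d)) (map complete (vertices (H d)))
  cover (edge (x ∷ xs) (y ∷ ys) a) with x Bool.≟ parity xs | adjacent-tails a
  ... | yes x≡ | _                  = inj₁ (covers xs x≡)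
  -- The first endpoint is odd; changing its head, or below the parity of its tail, makes the second
  -- one even.
  ... | no  x≢ | inj₁ (x≢y , refl)  = inj₂ (covers ys (≢-≢⇒≡ (≢-sym x≢y) x≢))
  ... | no  x≢ | inj₂ (refl , a′)   = inj₂ (covers ys (≢-≢⇒≡ x≢ (adjacent-parity xs ys a′)))

  matching : Fin (2 ^ d) → Edge (H (suc d))
  matching i = edge (false ∷ xs) (true ∷ xs) (zero , (λ ()) , differ)
    where
    xs = Inverse.from (Vec-Bool↔Fin d) i

    differ : ∀ j → j ≢ zero → lookup (false ∷ xs) j ≡ lookup (true ∷ xs) j
    differ zero    0≢0 = contradiction refl 0≢0
    differ (suc _) _   = refl

corollary14 : (∀ (a b : ℕ) → 1 ≤ a → 1 ≤ b → IsDem (K a b) (a ⊓ b) × IsVc (K a b) (a ⊓ b))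
    × (∀ (d : ℕ) → 1 ≤ d → IsDem (H d) (2 ^ (d ∸ 1)) × IsVc (H d) (2 ^ (d ∸ 1)))
corollary14 =
  (λ a b 1≤a 1≤b → K-dem a b 1≤a 1≤b , K-vc a b) ,
  λ { (suc d) _ → square-vc⇒dem (H (suc d)) H-square (H-vc d) , H-vc d }
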